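{- Let $\mathcal T$ be a péijí topology on $\mathbb Z$ of Brown type, let $\{\mathcal T_n\}_{n\in\mathbb N_1}$ be the maximal family inducing it and let $\mathcal M\subseteq\mathbb N_1$ be a determining monoid for $\mathcal T$ satisfying conditions (B1) and (B2). Assume $[a]_n\in B_n$ for some $a\in\mathbb Z$ and $n\in\mathcal M$. Then $a+n\mathbb Z$ and $a+n\mathbb N$ (with the subspace topologies induced by $\mathcal T$) are superconnected. In particular, if $\mathcal T$ is of Brown type then $(\mathbb Z,\mathcal T)$, $(\mathbb N,\mathcal T)$ and $(\mathbb N_1,\mathcal T)$ are superconnected.
   Context: Notation: $\mathbb N=\{0,1,2,\dots\}$, $\mathbb N_1=\mathbb N-\{0\}$; $\pi_n\colon\mathbb Z\to\mathbb Z/n\mathbb Z$, $a\mapsto[a]_n$, is reduction modulo $n$; if $n$ divides $m$, $\pi_n^m\colon\mathbb Z/m\mathbb Z\to\mathbb Z/n\mathbb Z$ is the natural projection. Subsets of $\mathbb Z$ carry the subspace topology. Péijí topologies: a family $\{\mathcal T_n\}_{n\in\mathbb N_1}$ of topologies, $\mathcal T_n$ on $\mathbb Z/n\mathbb Z$, induces the coarsest topology $\mathcal T$ on $\mathbb Z$ such that all maps $\pi_n\colon(\mathbb Z,\mathcal T)\to(\mathbb Z/n\mathbb Z,\mathcal T_n)$ are continuous. A péijí topology is a topology on $\mathbb Z$ obtained in this way. Two families are equivalent if they induce the same topology on $\mathbb Z$; a family is maximal if each $\mathcal T_n$ is the finest possible among all families in its equivalence class. The maximal family of $\mathcal T$ consists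 of the quotient topologies: $A\subseteq\mathbb Z/n\mathbb Z$ is in $\mathcal T_n$ iff $\pi_n^{ -1}(A)\in\mathcal T$. Determining monoid: let $\mathcal T$ be a péijí topology with maximal family $\{\mathcal T_n\}$. A nonempty subset $\mathcal M\subseteq\mathbb N_1$ is a determining set for $\mathcal T$ if $\{\mathcal T_n\}$ is equivalent to the family $\{\mathcal T'_n\}$ with $\mathcal T_n'=\mathcal T_n$ for $n\in\mathcal M$ and $\mathcal T_n'$ the trivial topology otherwise. It is a determining monoid if moreover it is a multiplicative submonoid of $\mathbb N_1$ (in particular $1\in\mathcal M$). $B_n$ denotes the intersection of all nonempty closed subsets of $(\mathbb Z/n\mathbb Z,\mathcal T_n)$, where $\{\mathcal T_n\}$ is the maximal family. $\mathcal T$ is of Brown type if it admits a determining monoid $\mathcal M$ such that for all $n,m\in\mathcal M$ with $n$ dividing $m$: (B1) the map $\pi_n^m\colon(\mathbb Z/m\mathbb Z,\mathcal T_m)\to(\mathbb Z/n\mathbb Z,\mathcal T_n)$ is open; (B2) $\pi_n^m(B_m)=B_n$. A topological space $X$ is superconnected if for any $r\in\mathbb N_1$ and any nonempty open subsets $U_1,\dots,U_r$ of $X$ one has $\bigcap_{i=1}^r\overline{U_i}\neq\emptyset$. -}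

module Defs where

open import Data.Empty using (⊥-elim)
open import Data.Fin.Base using (Fin; fromℕ<; toℕ)
open import Data.Integer.Base as ℤ using (ℤ; +_; 0ℤ)
open import Data.Integer.DivMod using (_%ℕ_; n%ℕd<d)
open import Data.Nat.Base using (ℕ; NonZero; _*_)
open import Data.Nat.Divisibility using (_∣_)
open import Data.Nat.Properties using (m*n≢0)
open import Data.Product using (Σ; ∃; _×_; _,_; proj₁; proj₂)
open import Data.Sum.Base using (_⊎_; inj₁; inj₂)
open import Function.Base using (_∘_)
open import Level using (Level; 0ℓ) renaming (suc to lsuc)
open import Relation.Binary.PropositionalEquality using (_≡_)
open import Relation.Nullary.Negation using (¬_)
open import Relation.Unary
  using (Pred; _∈_; _⊆_; _≐_; _∩_; ∁; ∅; U; ⋃; ⋂; Satisfiable; Universal; _⊢_)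

-- The powerset of X is Pred X 0ℓ.  Indexing unions by small types is no
-- restriction: the union of any collection of opens, as soon as it is a
-- Pred X 0ℓ, can be re-indexed by its own points.

record Topology (X : Set) : Set₂ where
  field
    Open      : Pred (Pred X 0ℓ) (lsuc 0ℓ)
    Open-resp : ∀ {A B} → A ≐ B → Open A → Open B
    ∅-open    : Open ∅
    U-open    : Open U
    ∩-open    : ∀ {A B} → Open A → Open B → Open (A ∩ B)
    ⋃-open    : ∀ {I : Set} (A : I → Pred X 0ℓ) → (∀ i → Open (A i)) → Open (⋃ I A)

open Topology public

private
  variable
    X Y : Set
    ℓ   : Level

infix 4 _≼_

-- S is coarser than T.
_≼_ : Topology X → Topology X → Set₁
S ≼ T = Open S ⊆ Open T

Continuous : Topology X → Topology Y → (X → Y) → Set₁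
Continuous S T f = ∀ {A} → Open T A → Open S (f ⊢ A)

image : (X → Y) → Pred X ℓ → Pred Y ℓ
image f A y = ∃ λ x → x ∈ A × f x ≡ y

OpenMap : Topology X → Topology Y → (X → Y) → Set₁
OpenMap S T f = ∀ {A} → Open S A → Open T (image f A)

-- Complements of opens; asking instead that ∁ C be open would only be the same
-- classically.
Closed : Topology X → Pred X 0ℓ → Set₁
Closed T C = ∃ λ A → Open T A × C ≐ ∁ A

closure : Topology X → Pred X 0ℓ → Pred X (lsuc 0ℓ)
closure T A x = ∀ C → Closed T C → A ⊆ C → x ∈ C

Superconnected : Topology X → Set₁
Superconnected {X} T =
  ∀ (r : ℕ) .{{_ : NonZero r}} (A : Fin r → Pred X 0ℓ) →
  (∀ i → Open T (A i)) → (∀ i → Satisfiable (A i)) →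
  Satisfiable (⋂ (Fin r) (λ i → closure T (A i)))

subspace : Topology X → (S : Pred X 0ℓ) → Topology (Σ X S)
subspace T S = record
  { Open      = λ A → ∃ λ B → Open T B × A ≐ (proj₁ ⊢ B)
  ; Open-resp = λ { (f , g) (B , oB , h , k) → B , oB , h ∘ g , f ∘ k }
  ; ∅-open    = ∅ , ∅-open T , (λ ()) , (λ ())
  ; U-open    = U , U-open T , _ , _
  ; ∩-open    = λ { (B , oB , h , k) (B′ , oB′ , h′ , k′) →
                    B ∩ B′ , ∩-open T oB oB′
                    , (λ { (p , q) → h p , h′ q }) , (λ { (p , q) → k p , k′ q }) }
  ; ⋃-open    = λ A o →
                    ⋃ _ (proj₁ ∘ o) , ⋃-open T _ (proj₁ ∘ proj₂ ∘ o)
                    , (λ { (i , p) → i , proj₁ (proj₂ (proj₂ (o i))) p })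
                    , (λ { (i , p) → i , proj₂ (proj₂ (proj₂ (o i))) p })
  }

-- ℤ/nℤ is Fin n, a class being represented by its least nonnegative element.

π : (n : ℕ) .{{_ : NonZero n}} → ℤ → Fin n
π n a = fromℕ< (n%ℕd<d a n)

πᵐₙ : {m n : ℕ} .{{_ : NonZero n}} → n ∣ m → Fin m → Fin n
πᵐₙ {n = n} _ x = π n (+ toℕ x)

Family : Set₂
Family = (n : ℕ) .{{_ : NonZero n}} → Topology (Fin n)

Induces : Family → Topology ℤ → Set₂
Induces F T = AllContinuous T × (∀ T′ → AllContinuous T′ → T ≼ T′)
  where
  AllContinuous : Topology ℤ → Set₁
  AllContinuous S = ∀ n .{{_ : NonZero n}} → Continuous S (F n) (π n)

Péijí : Topology ℤ → Set₂
Péijí T = ∃ λ F → Induces F T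

Equivalent : Family → Family → Set₂
Equivalent F G = ∃ λ T → Induces F T × Induces G T

Maximal : Family → Set₂
Maximal F = ∀ G → Equivalent F G → ∀ n .{{_ : NonZero n}} → G n ≼ F n

MaximalFamily : Topology ℤ → Family → Set₂
MaximalFamily T F = Induces F T × Maximal F

Subset-ℕ₁ : Set₁
Subset-ℕ₁ = (n : ℕ) .{{_ : NonZero n}} → Set

-- The family equal to F n for n in M and trivial otherwise.  Membership in M
-- need not be decidable, so the two cases are merged into one formula;
-- restrict-in and restrict-out below show that it is the intended family.

restrict : Subset-ℕ₁ → Family → Family
restrict M F n = record
  { Open      = O
  ; Open-resp = λ { (f , g) o x∈B → resp f g (o (g x∈B)) }
  ; ∅-open    = λ ()
  ; U-open    = λ _ → inj₂ _
  ; ∩-open    = λ { o o′ (p , q) → inter (o p) (o′ q) }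
  ; ⋃-open    = λ { A o (i , p) → union A o i (o i p) }
  }
  where
  Local : Pred (Fin n) 0ℓ → Set₁
  Local A = (M n × Open (F n) A) ⊎ Universal A

  O : Pred (Fin n) 0ℓ → Set₁
  O A = ∀ {x} → x ∈ A → Local A

  resp : ∀ {A B} → A ⊆ B → B ⊆ A → Local A → Local B
  resp f g (inj₁ (m , o)) = inj₁ (m , Open-resp (F n) (f , g) o)
  resp f g (inj₂ u)       = inj₂ (λ x → f (u x))

  inter : ∀ {A B} → Local A → Local B → Local (A ∩ B)
  inter (inj₁ (m , o)) (inj₁ (_ , o′)) = inj₁ (m , ∩-open (F n) o o′)
  inter (inj₁ (m , o)) (inj₂ u)        =
    inj₁ (m , Open-resp (F n) ((λ p → p , u _) , proj₁) o)
  inter (inj₂ u)       (inj₁ (m , o))  =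
    inj₁ (m , Open-resp (F n) ((λ p → u _ , p) , proj₂) o)
  inter (inj₂ u)       (inj₂ v)        = inj₂ (λ x → u x , v x)

  open-of : ∀ {A} → M n → Local A → Open (F n) A
  open-of m (inj₁ (_ , o)) = o
  open-of m (inj₂ u)       = Open-resp (F n) ((λ _ → u _) , _) (U-open (F n))

  union : ∀ {I : Set} (A : I → Pred (Fin n) 0ℓ) → (∀ i → O (A i)) →
          ∀ i → Local (A i) → Local (⋃ I A)
  union A o i (inj₂ u)       = inj₂ (λ x → i , u x)
  union A o i (inj₁ (m , _)) = inj₁ (m ,
    Open-resp (F n)
      ((λ { ((j , _ , _) , p) → j , p }) , (λ { {x} (j , p) → (j , x , p) , p }))
      (⋃-open (F n) {∃ λ j → Satisfiable (A j)} (A ∘ proj₁)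
        (λ { (j , _ , p) → open-of m (o j p) })))

module _ (M : Subset-ℕ₁) (F : Family) (n : ℕ) .{{_ : NonZero n}} where

  restrict-in : M n → restrict M F n ≼ F n × F n ≼ restrict M F n
  restrict-in m = to , λ o _ → inj₁ (m , o)
    where
    nbhd : ∀ {A} → (M n × Open (F n) A) ⊎ Universal A → Open (F n) A
    nbhd (inj₁ (_ , o)) = o
    nbhd (inj₂ u)       = Open-resp (F n) ((λ _ → u _) , _) (U-open (F n))

    to : restrict M F n ≼ F n
    to {A} o = Open-resp (F n) (proj₂ , λ {x} p → (x , p) , p)
      (⋃-open (F n) {Satisfiable A} (λ _ → A) (λ { (_ , p) → nbhd (o p) }))

  restrict-out : ¬ M n → ∀ {A} → Open (restrict M F n) A → Satisfiable A → Universal A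
  restrict-out ¬m o (_ , p) with o p
  ... | inj₁ (m , _) = ⊥-elim (¬m m)
  ... | inj₂ u       = u

record DeterminingSet (F : Family) (M : Subset-ℕ₁) : Set₂ where
  field
    nonempty    : Σ ℕ λ n → Σ (NonZero n) λ n≢0 → M n {{n≢0}}
    determining : Equivalent F (restrict M F)

record DeterminingMonoid (F : Family) (M : Subset-ℕ₁) : Set₂ where
  field
    determiningSet : DeterminingSet F M
    1∈M            : M 1
    *-closed       : ∀ m n .{{_ : NonZero m}} .{{_ : NonZero n}} →
                     M m → M n → M (m * n) {{m*n≢0 m n}}

𝔹 : Family → (n : ℕ) .{{_ : NonZero n}} → Pred (Fin n) (lsuc 0ℓ)
𝔹 F n x = ∀ C → Closed (F n) C → Satisfiable C → x ∈ C

B1 : Family → Subset-ℕ₁ → Set₁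
B1 F M = ∀ n m .{{_ : NonZero n}} .{{_ : NonZero m}} → M n → M m →
         (n∣m : n ∣ m) → OpenMap (F m) (F n) (πᵐₙ n∣m)

B2 : Family → Subset-ℕ₁ → Set₁
B2 F M = ∀ n m .{{_ : NonZero n}} .{{_ : NonZero m}} → M n → M m →
         (n∣m : n ∣ m) → image (πᵐₙ n∣m) (𝔹 F m) ≐ 𝔹 F n

BrownType : Topology ℤ → Set₂
BrownType T = ∃ λ F → MaximalFamily T F ×
              ∃ λ M → DeterminingMonoid F M × B1 F M × B2 F M

_+[_]ℤ _+[_]ℕ : ℤ → ℕ → Pred ℤ 0ℓ
(a +[ n ]ℤ) x = ∃ λ (k : ℤ) → x ≡ a ℤ.+ + n ℤ.* k
(a +[ n ]ℕ) x = ∃ λ (k : ℕ) → x ≡ a ℤ.+ + n ℤ.* + k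

ℕ⊆ℤ ℕ₁⊆ℤ : Pred ℤ 0ℓ
ℕ⊆ℤ  x = 0ℤ ℤ.≤ x
ℕ₁⊆ℤ x = 0ℤ ℤ.< x

{-# OPTIONS --safe #-}

-- Since M is a monoid and F is maximal, the sets π m ⁻¹(V) with m ∈ M and V
-- open in F m form a base of T.  Given nonempty opens of a + nℤ, choose one
-- m ∈ M divisible by n such that each of them contains a full class modulo m,
-- and, by (B2), a point b of a + nℤ whose class modulo m lies in 𝔹 F m.  A basic
-- neighbourhood π k ⁻¹(V) of b may be taken with m ∣ k; by (B1) the image of V
-- in ℤ/mℤ is open, and an open set meeting 𝔹 F m is everything.  Hence every
-- neighbourhood of b meets every class modulo m, so b lies in all the closures.

module Submission where

open import Data.Fin.Base using (Fin; zero; suc; toℕ; fromℕ<)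
open import Data.Fin.Properties using (toℕ-fromℕ<; fromℕ<-cong; fromℕ<-toℕ; toℕ<n)
open import Data.Integer.Base as ℤ
  using (ℤ; +_; -[1+_]; 0ℤ; ∣_∣; _+_; _*_; -_; _-_; _≤_)
open import Data.Integer.DivMod using (_%ℕ_; _/ℕ_; n%ℕd<d; a≡a%ℕn+[a/ℕn]*n)
import Data.Integer.Properties as ℤ
open import Data.Integer.Tactic.RingSolver using (solve-∀)
open import Data.Nat.Base as ℕ using (ℕ; zero; suc; NonZero)
open import Data.Nat.Divisibility
  using (_∣_; divides-refl; ∣-refl; ∣-trans; m∣m*n; n∣m*n)
open import Data.Nat.DivMod using (_%_; [m+kn]%n≡m%n; m<n⇒m%n≡m)
open import Data.Nat.Properties using (m*n≢0; m≤n*m)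
open import Data.Product using (∃; ∃₂; _×_; _,_; proj₁; proj₂; map₂)
open import Data.Sum.Base using (inj₁; inj₂)
open import Function.Base using (id; _∘_)
open import Level using (0ℓ)
open import Relation.Binary.PropositionalEquality
open import Relation.Nullary.Negation using (¬_)
open import Relation.Unary using (Pred; _∈_; _⊆_; _∩_; ∁; U; Satisfiable; _⊢_)
open import Defs

-- Residue classes

module _ (n : ℕ) .{{_ : NonZero n}} where

  <-congruent⇒≡ : ∀ {r s} → r ℕ.< n → s ℕ.< n → ∀ k → + r ≡ + s + k * + n → r ≡ s
  <-congruent⇒≡ {r} {s} r<n s<n (+ j) eq = begin
    r                    ≡⟨ m<n⇒m%n≡m r<n ⟨
    r % n                ≡⟨ cong (_% n) (ℤ.+-injective r≡s+jn) ⟩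
    (s ℕ.+ j ℕ.* n) % n  ≡⟨ [m+kn]%n≡m%n s j n ⟩
    s % n                ≡⟨ m<n⇒m%n≡m s<n ⟩
    s                    ∎
    where
    open ≡-Reasoning
    r≡s+jn : + r ≡ + (s ℕ.+ j ℕ.* n)
    r≡s+jn = trans eq (cong (λ x → + s + x) (sym (ℤ.pos-* j n)))
  -- Moving the negative multiple across makes it positive and exchanges the two remainders.
  <-congruent⇒≡ {r} {s} r<n s<n -[1+ j ] eq =
    sym (<-congruent⇒≡ s<n r<n (+ suc j)
      (trans (cancel (+ s) (+ suc j) (+ n)) (cong (_+ + suc j * + n) (sym eq))))
    where
    cancel : ∀ s j n → s ≡ s + - j * n + j * n
    cancel = solve-∀

  π-+* : ∀ z k → π n (z + + n * k) ≡ π n z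
  π-+* z k = fromℕ<-cong _ _
    -- The multiplier comes from subtracting the division equations of `z` and `z′`.
    (<-congruent⇒≡ (n%ℕd<d z′ n) (n%ℕd<d z n) (z /ℕ n + k - z′ /ℕ n)
      (shift {r = + (z %ℕ n)} (z /ℕ n) (z′ /ℕ n)
        (a≡a%ℕn+[a/ℕn]*n z n) (a≡a%ℕn+[a/ℕn]*n z′ n))) _ _
    where
    z′ : ℤ
    z′ = z + + n * k
    shift : ∀ {z r r′} q q′ → z ≡ r + q * + n → z + + n * k ≡ r′ + q′ * + n →
            r′ ≡ r + (q + k - q′) * + n
    shift {r = r} {r′} q q′ refl eq = begin
      r′                                ≡⟨ isolate r′ q′ (+ n) ⟩
      r′ + q′ * + n - q′ * + n          ≡⟨ cong (_- q′ * + n) eq ⟨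
      r + q * + n + + n * k - q′ * + n  ≡⟨ collect r q q′ (+ n) k ⟩
      r + (q + k - q′) * + n            ∎
      where
      open ≡-Reasoning
      isolate : ∀ r q n → r ≡ r + q * n - q * n
      isolate = solve-∀
      collect : ∀ r q q′ n k → r + q * n + n * k - q′ * n
                               ≡ r + (q + k - q′) * n
      collect = solve-∀

  π-decompose : ∀ z → z ≡ + toℕ (π n z) + + n * (z /ℕ n)
  π-decompose z = begin
    z                               ≡⟨ a≡a%ℕn+[a/ℕn]*n z n ⟩
    + (z %ℕ n) + z /ℕ n * + n       ≡⟨ cong₂ (λ r x → + r + x) (sym (toℕ-fromℕ< _)) (ℤ.*-comm (z /ℕ n) (+ n)) ⟩
    + toℕ (π n z) + + n * (z /ℕ n)  ∎
    where open ≡-Reasoning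

  π-≡⇒∃ : ∀ y z → π n y ≡ π n z → ∃ λ k → y ≡ z + + n * k
  π-≡⇒∃ y z eq = q - q′ , (begin
    y                                          ≡⟨ π-decompose y ⟩
    + toℕ (π n y) + + n * q                    ≡⟨ cong (λ x → + toℕ x + + n * q) eq ⟩
    + toℕ (π n z) + + n * q                    ≡⟨ regroup (+ toℕ (π n z)) (+ n) q q′ ⟩
    + toℕ (π n z) + + n * q′ + + n * (q - q′)  ≡⟨ cong (_+ + n * (q - q′)) (π-decompose z) ⟨
    z + + n * (q - q′)                         ∎)
    where
    open ≡-Reasoning
    q q′ : ℤ
    q  = y /ℕ n
    q′ = z /ℕ n
    regroup : ∀ r n q q′ → r + n * q ≡ r + n * q′ + n * (q - q′)
    regroup = solve-∀

  π-toℕ : ∀ x → π n (+ toℕ x) ≡ x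
  π-toℕ x = trans (fromℕ<-cong _ _ (m<n⇒m%n≡m x<n) _ x<n) (fromℕ<-toℕ x x<n)
    where
    x<n : toℕ x ℕ.< n
    x<n = toℕ<n x

  -- Since `n` is at least 1, adding `n` times the distance from `z` to `c` is enough.
  π-representative-≥ : ∀ c z → ∃ λ z′ → c ≤ z′ × π n z′ ≡ π n z
  π-representative-≥ c z = z + + n * + ∣ c - z ∣ , bound , π-+* z _
    where
    open ℤ.≤-Reasoning
    i≤+∣i∣ : ∀ i → i ≤ + ∣ i ∣
    i≤+∣i∣ (+ _)    = ℤ.≤-refl
    i≤+∣i∣ -[1+ _ ] = ℤ.-≤+
    complete : ∀ c z → c ≡ z + (c - z)
    complete = solve-∀
    bound : c ≤ z + + n * + ∣ c - z ∣
    bound = begin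
      c                        ≡⟨ complete c z ⟩
      z + (c - z)              ≤⟨ ℤ.+-monoʳ-≤ z (i≤+∣i∣ (c - z)) ⟩
      z + + ∣ c - z ∣          ≤⟨ ℤ.+-monoʳ-≤ z (ℤ.+≤+ (m≤n*m ∣ c - z ∣ n)) ⟩
      z + + (n ℕ.* ∣ c - z ∣)  ≡⟨ cong (λ i → z + i) (ℤ.pos-* n ∣ c - z ∣) ⟩
      z + + n * + ∣ c - z ∣    ∎

  a≤a+n*k⇒k≡+∣k∣ : ∀ a k → a ≤ a + + n * k → k ≡ + ∣ k ∣
  a≤a+n*k⇒k≡+∣k∣ a k a≤ = sym (ℤ.0≤i⇒+∣i∣≡i (ℤ.*-cancelˡ-≤-pos 0ℤ k (+ n) {{pos n}} (begin
    + n * 0ℤ             ≡⟨ ℤ.*-zeroʳ (+ n) ⟩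
    0ℤ                   ≡⟨ ℤ.+-inverseˡ a ⟨
    - a + a              ≤⟨ ℤ.+-monoʳ-≤ (- a) a≤ ⟩
    - a + (a + + n * k)  ≡⟨ cancel a (+ n * k) ⟩
    + n * k              ∎)))
    where
    open ℤ.≤-Reasoning
    pos : ∀ n .{{_ : NonZero n}} → ℤ.Positive (+ n)
    pos (suc _) = _
    cancel : ∀ a x → - a + (a + x) ≡ x
    cancel = solve-∀

-- `πᵐₙ` goes through the least representative modulo `m`, which differs from `z` by a multiple of
-- `m`, hence of `n`.
πᵐₙ-π : ∀ {m n} .{{_ : NonZero m}} .{{_ : NonZero n}} (n∣m : n ∣ m) z →
        πᵐₙ n∣m (π m z) ≡ π n z
πᵐₙ-π {m} {n} n∣m@(divides-refl q) z = begin
  π n r                      ≡⟨ π-+* n r (+ q * k) ⟨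
  π n (r + + n * (+ q * k))  ≡⟨ cong (λ x → π n (r + x)) (reassoc (+ n) (+ q) k) ⟩
  π n (r + + q * + n * k)    ≡⟨ cong (λ x → π n (r + x * k)) (ℤ.pos-* q n) ⟨
  π n (r + + m * k)          ≡⟨ cong (π n) (π-decompose m z) ⟨
  π n z                      ∎
  where
  open ≡-Reasoning
  r k : ℤ
  r = + toℕ (π m z)
  k = z /ℕ m
  reassoc : ∀ n q k → n * (q * k) ≡ q * n * k
  reassoc = solve-∀

π-≡-∣ : ∀ {m n} .{{_ : NonZero m}} .{{_ : NonZero n}} → n ∣ m → ∀ y z →
        π m y ≡ π m z → π n y ≡ π n z
π-≡-∣ n∣m y z eq =
  trans (sym (πᵐₙ-π n∣m y)) (trans (cong (πᵐₙ n∣m) eq) (πᵐₙ-π n∣m z))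

-- Maximal families and the base given by a determining monoid

quotient : Topology ℤ → Family
quotient T n = record
  { Open      = λ A → Open T (π n ⊢ A)
  ; Open-resp = λ { (f , g) → Open-resp T (f , g) }
  ; ∅-open    = ∅-open T
  ; U-open    = U-open T
  ; ∩-open    = ∩-open T
  ; ⋃-open    = λ A → ⋃-open T (λ i → π n ⊢ A i)
  }

-- The quotient family also induces `T`: its maps are continuous by definition, and a topology
-- making them continuous does the same for the coarser `F`. So it is equivalent to `F`, and
-- maximality applies.
maximal⇒quotient≼ : ∀ {T F} → MaximalFamily T F →
                    ∀ n .{{_ : NonZero n}} → quotient T n ≼ F n
maximal⇒quotient≼ {T} {F} (induces@(continuous , coarsest) , maximal) =
  maximal (quotient T) (T , induces , (λ n → id) ,
    λ T′ cont′ → coarsest T′ (λ n {A} → cont′ n {A} ∘ continuous n))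

module _ {T : Topology ℤ} {F : Family} (max : MaximalFamily T F)
         {M : Subset-ℕ₁} (monoid : DeterminingMonoid F M) where

  open DeterminingMonoid monoid
  open DeterminingSet determiningSet

  record Modulus : Set where
    constructor modulus
    field
      value     : ℕ
      {{value≢0}} : NonZero value
      value∈M   : M value

  open Modulus

  infixl 7 _⊛_
  _⊛_ : Modulus → Modulus → Modulus
  m ⊛ n = modulus (value m ℕ.* value n) {{m*n≢0 (value m) (value n)}}
            (*-closed (value m) (value n) (value∈M m) (value∈M n))

  πM : (m : Modulus) → ℤ → Fin (value m)
  πM m = π (value m)

  commonMultiple : ∀ {r} (n : Modulus) (m : Fin r → Modulus) →
                   ∃ λ l → value n ∣ value l × (∀ i → value (m i) ∣ value l)
  commonMultiple {zero}  n m = n , ∣-refl , λ ()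
  commonMultiple {suc r} n m with commonMultiple n (m ∘ suc)
  ... | l , n∣l , m∣l = m zero ⊛ l , ∣-trans n∣l l∣ , λ
    { zero    → m∣m*n (value l)
    ; (suc i) → ∣-trans (m∣l i) l∣ }
    where
    l∣ : value l ∣ value (m zero) ℕ.* value l
    l∣ = n∣m*n (value (m zero))

  record BasicNbhd (A : Pred ℤ 0ℓ) (m : Modulus) (x : ℤ) : Set₁ where
    field
      V      : Pred (Fin (value m)) 0ℓ
      V-open : Open (F (value m)) V
      x∈V    : πM m x ∈ V
      V⊆A    : (πM m ⊢ V) ⊆ A

  open BasicNbhd

  widen : ∀ {A B m x} → A ⊆ B → BasicNbhd A m x → BasicNbhd B m x
  widen A⊆B N = record { V = V N ; V-open = V-open N ; x∈V = x∈V N ; V⊆A = A⊆B ∘ V⊆A N }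

  ∩-BasicNbhd : ∀ {A B m x} → BasicNbhd A m x → BasicNbhd B m x → BasicNbhd (A ∩ B) m x
  ∩-BasicNbhd {m = m} N N′ = record
    { V      = V N ∩ V N′
    ; V-open = ∩-open (F (value m)) (V-open N) (V-open N′)
    ; x∈V    = x∈V N , x∈V N′
    ; V⊆A    = λ { (p , p′) → V⊆A N p , V⊆A N′ p′ }
    }

  -- The pullback of `V` to ℤ/kℤ has the same preimage in ℤ as `V`, an open set of `T`; maximality
  -- therefore makes the pullback open in `F (value k)`.
  refine : ∀ {A m k x} → value m ∣ value k → BasicNbhd A m x → BasicNbhd A k x
  refine {m = m} {k} {x} m∣k N = record
    { V      = πᵐₙ m∣k ⊢ V N
    ; V-open = maximal⇒quotient≼ {T} {F} max (value k)
                 (Open-resp T ((λ {y} → subst (V N) (sym (πᵐₙ-π m∣k y))) ,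
                              (λ {y} → subst (V N) (πᵐₙ-π m∣k y)))
                   (proj₁ (proj₁ max) (value m) (V-open N)))
    ; x∈V    = subst (V N) (sym (πᵐₙ-π m∣k x)) (x∈V N)
    ; V⊆A    = λ {y} → V⊆A N ∘ subst (V N) (πᵐₙ-π m∣k y)
    }

  basic : Topology ℤ
  basic = record
    { Open      = λ A → ∀ {x} → x ∈ A → ∃ λ m → BasicNbhd A m x
    ; Open-resp = λ { (A⊆B , B⊆A) o x∈B → map₂ (widen A⊆B) (o (B⊆A x∈B)) }
    ; ∅-open    = λ ()
    ; U-open    = λ _ → modulus 1 1∈M , record
                    { V = U ; V-open = U-open (F 1) ; x∈V = _ ; V⊆A = _ }
    ; ∩-open    = λ { o o′ (p , p′) → inter (o p) (o′ p′) }
    ; ⋃-open    = λ { A o (i , p) → map₂ (widen (i ,_)) (o i p) }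
    }
    where
    inter : ∀ {A B x} → (∃ λ m → BasicNbhd A m x) → (∃ λ m → BasicNbhd B m x) →
            ∃ λ m → BasicNbhd (A ∩ B) m x
    -- Both neighbourhoods are refined to the product modulus, which stays in `M`.
    inter (m , N) (m′ , N′) = m ⊛ m′ ,
      ∩-BasicNbhd (refine (m∣m*n (value m′)) N) (refine (n∣m*n (value m)) N′)

  -- `F` and `restrict M F` induce a common `T″`. As the coarsest topology for `F`, `T` is coarser
  -- than `T″`; as the coarsest for `restrict M F`, `T″` is coarser than `basic`.
  T≼basic : T ≼ basic
  T≼basic {A} o with determining
  ... | T″ , (continuous , _) , (_ , coarsest) =
    coarsest basic nbhd (proj₂ (proj₁ max) T″ continuous o)
    where
    nbhd : ∀ n .{{_ : NonZero n}} → Continuous basic (restrict M F n) (π n)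
    -- Matching on `suc` yields the relevant `NonZero` instance that `Modulus` stores; the one in
    -- scope is irrelevant.
    nbhd n@(suc _) {A} o {x} x∈A with o x∈A
    ... | inj₁ (n∈M , A-open) = modulus n n∈M , record
      { V = A ; V-open = A-open ; x∈V = x∈A ; V⊆A = id }
    -- Here `n` may lie outside `M`, but the preimage of `A` is all of ℤ, so modulus 1 serves.
    ... | inj₂ A-universal    = modulus 1 1∈M , record
      { V = U ; V-open = U-open (F 1) ; x∈V = _ ; V⊆A = λ {y} _ → A-universal (π n y) }

  -- Density at points of 𝔹 and superconnected subspaces

  open-meeting-𝔹-is-dense : ∀ n .{{_ : NonZero n}} {A : Pred (Fin n) 0ℓ} {x} →
                            Open (F n) A → x ∈ 𝔹 F n → x ∈ A → ∀ y → ¬ ¬ y ∈ A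
  open-meeting-𝔹-is-dense n {A} A-open x∈𝔹 x∈A y y∉A =
    -- A point `y` outside `A` would make `∁ A` a nonempty closed set, which then contains `x`.
    x∈𝔹 (∁ A) (A , A-open , id , id) (y , y∉A) x∈A

  open-contains-class : ∀ {S A} → Open (subspace T S) A → Satisfiable A →
                        ∃₂ λ m u → u ∈ S × (∀ s → πM m (proj₁ s) ≡ πM m u → s ∈ A)
  open-contains-class (B , B-open , A⊆B , B⊆A) ((u , u∈S) , u∈A) with T≼basic B-open (A⊆B u∈A)
  ... | m , N = m , u , u∈S , λ s s≡u → B⊆A (V⊆A N (subst (V N) (sym s≡u) (x∈V N)))

  -- The conditions on `S` say that it lies in the class of `a` modulo `n` and meets every finer
  -- class inside it. Both kinds of progression and all cofinal sets are of this form.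
  subspace-superconnected :
    B1 F M → B2 F M → ∀ (a : ℤ) (n : Modulus) → πM n a ∈ 𝔹 F (value n) →
    (S : Pred ℤ 0ℓ) → (∀ {z} → z ∈ S → πM n z ≡ πM n a) →
    (∀ m .{{_ : NonZero m}} → value n ∣ m → ∀ z → πM n z ≡ πM n a →
      ∃ λ z′ → z′ ∈ S × π m z′ ≡ π m z) →
    Superconnected (subspace T S)
  subspace-superconnected b1 b2 a n a∈𝔹 S S⊆ lift r A A-open A-nonempty
    with class ← (λ i → open-contains-class (A-open i) (A-nonempty i))
    with m , n∣m , mᵢ∣m ← commonMultiple n (λ i → proj₁ (class i))
    -- (B2) lifts the class of `a` to a point of 𝔹 modulo `m`; a representative of it in `S` is the
    -- common adherent point.
    with x , x∈𝔹 , x↦a ← proj₂ (b2 (value n) (value m) (value∈M n) (value∈M m) n∣m) a∈𝔹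
    with b , b∈S , b≡x ← lift (value m) n∣m (+ toℕ x) x↦a
    = (b , b∈S) , adherent
    where
    b∈𝔹 : πM m b ∈ 𝔹 F (value m)
    b∈𝔹 = subst (𝔹 F (value m)) (sym (trans b≡x (π-toℕ (value m) x))) x∈𝔹

    adherent : ∀ i → (b , b∈S) ∈ closure (subspace T S) (A i)
    adherent i C (O , (O′ , O′-open , O⊆O′ , O′⊆O) , C⊆∁O , ∁O⊆C) A⊆C
      with mᵢ , u , u∈S , class⊆A ← class i in eq = ∁O⊆C b∉O
      where
      mᵢ∣ : value mᵢ ∣ value m
      mᵢ∣ = subst (λ c → value (proj₁ c) ∣ value m) eq (mᵢ∣m i)

      no-nbhd : ∀ k → value m ∣ value k → ¬ BasicNbhd O′ k b
      -- By (B1) the image of `V K` modulo `m` is open, and it meets 𝔹 at the class of `b`; hence it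
      -- cannot omit the class of `u`.
      no-nbhd k m∣k K = open-meeting-𝔹-is-dense (value m)
        (b1 (value m) (value k) (value∈M m) (value∈M k) m∣k (V-open K))
        b∈𝔹 (πM k b , x∈V K , πᵐₙ-π m∣k b) (πM m u) avoid
        where
        avoid : ¬ πM m u ∈ image (πᵐₙ m∣k) (V K)
        -- A representative `w` of `v` in `S` is congruent to `u` modulo `m`, so it lies in `A i`
        -- and thus in `C`; but its class modulo `k` puts it in `O`, the complement.
        avoid (v , v∈V , v≡u)
          with w , w∈S , w≡v ← lift (value k) (∣-trans n∣m m∣k) (+ toℕ v)
                                 (trans (π-≡-∣ n∣m (+ toℕ v) u v≡u) (S⊆ u∈S))
          = C⊆∁O
              (A⊆C (class⊆A (w , w∈S)
                (π-≡-∣ mᵢ∣ w u (trans (π-≡-∣ m∣k w (+ toℕ v) w≡v) v≡u))))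
              (O′⊆O (V⊆A K (subst (V K) (sym (trans w≡v (π-toℕ (value k) v))) v∈V)))

      -- `C` is the complement of `O`, so the goal is negative and density up to double negation
      -- suffices. The modulus of the neighbourhood is multiplied by `m` so that (B1) applies.
      b∉O : ¬ (b , b∈S) ∈ O
      b∉O b∈O with k , N ← T≼basic O′-open (O⊆O′ b∈O) =
        no-nbhd (m ⊛ k) (m∣m*n (value k)) (refine (n∣m*n (value m)) N)

-- Arithmetic progressions and cofinal sets

module _ {T : Topology ℤ} {F : Family} (max : MaximalFamily T F)
         {M : Subset-ℕ₁} (monoid : DeterminingMonoid F M) (b1 : B1 F M) (b2 : B2 F M) where

  progressions-superconnected :
    ∀ (a : ℤ) (n : ℕ) .{{_ : NonZero n}} → M n → π n a ∈ 𝔹 F n →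
    Superconnected (subspace T (a +[ n ]ℤ)) × Superconnected (subspace T (a +[ n ]ℕ))
  progressions-superconnected a n@(suc _) n∈M a∈𝔹 =
    subspace-superconnected {T} {F} max monoid b1 b2 a (modulus n n∈M) a∈𝔹 (a +[ n ]ℤ)
      (λ { (k , refl) → π-+* n a k })
      (λ m n∣m z z≡a → z , π-≡⇒∃ n z a z≡a , refl) ,
    subspace-superconnected {T} {F} max monoid b1 b2 a (modulus n n∈M) a∈𝔹 (a +[ n ]ℕ)
      (λ { (k , refl) → π-+* n a (+ k) })
      lift
    where
    lift : ∀ m .{{_ : NonZero m}} → n ∣ m → ∀ z → π n z ≡ π n a →
           ∃ λ z′ → z′ ∈ (a +[ n ]ℕ) × π m z′ ≡ π m z
    lift m n∣m z z≡a
      -- A representative that is at least `a` has a nonnegative coefficient of `n`.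
      with z′ , a≤z′ , z′≡z ← π-representative-≥ m a z
      with k , refl ← π-≡⇒∃ n z′ a (trans (π-≡-∣ n∣m z′ z z′≡z) z≡a)
      = z′ , (∣ k ∣ , cong (λ k → a + + n * k) (a≤a+n*k⇒k≡+∣k∣ n a k a≤z′)) , z′≡z

  cofinal-superconnected : (S : Pred ℤ 0ℓ) → ∀ c → (c ≤_) ⊆ S → Superconnected (subspace T S)
  cofinal-superconnected S c c≤⊆S =
    subspace-superconnected {T} {F} max monoid b1 b2 0ℤ (modulus 1 (DeterminingMonoid.1∈M monoid))
      -- ℤ/1ℤ has a single point, which every nonempty closed set contains, so it belongs to 𝔹.
      (λ { C _ (zero , 0∈C) → 0∈C }) S (λ {z} _ → Fin1-≡ (π 1 z) (π 1 0ℤ))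
      (λ m _ z _ → map₂ (λ { (c≤z′ , z′≡z) → c≤⊆S c≤z′ , z′≡z }) (π-representative-≥ m c z))
    where
    Fin1-≡ : (x y : Fin 1) → x ≡ y
    Fin1-≡ zero zero = refl

-- `subspace T U` lives on pairs rather than on `X`; open and closed sets are carried over along
-- `proj₁`.
superconnected-U⁻ : ∀ {X} {T : Topology X} → Superconnected (subspace T U) → Superconnected T
superconnected-U⁻ sc r A A-open A-nonempty
  with (b , _) , b∈ ← sc r (λ i → proj₁ ⊢ A i) (λ i → A i , A-open i , id , id)
                         (λ i → (proj₁ (A-nonempty i) , _) , proj₂ (A-nonempty i))
  = b , λ i C (O , O-open , C⊆ , ⊆C) A⊆C →
      b∈ i (proj₁ ⊢ C) (proj₁ ⊢ O , (O , O-open , id , id) , C⊆ , ⊆C) A⊆C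

theorem2p25 : (∀ (T : Topology ℤ) → Péijí T → BrownType T →
    ∀ (F : Family) → MaximalFamily T F →
    ∀ (M : Subset-ℕ₁) → DeterminingMonoid F M → B1 F M → B2 F M →
    ∀ (a : ℤ) (n : ℕ) .{{_ : NonZero n}} → M n → π n a ∈ 𝔹 F n →
    Superconnected (subspace T (a +[ n ]ℤ)) ×
    Superconnected (subspace T (a +[ n ]ℕ)))
    ×
    (∀ (T : Topology ℤ) → Péijí T → BrownType T →
    Superconnected T ×
    Superconnected (subspace T ℕ⊆ℤ) ×
    Superconnected (subspace T ℕ₁⊆ℤ))
theorem2p25 =
  (λ T _ _ F max M monoid b1 b2 → progressions-superconnected {T} {F} max monoid b1 b2) ,
  (λ { T _ (F , max , M , monoid , b1 , b2) →
    let cofinal = cofinal-superconnected {T} {F} max monoid b1 b2 in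
    superconnected-U⁻ {T = T} (cofinal U 0ℤ _) ,
    cofinal ℕ⊆ℤ 0ℤ id ,
    cofinal ℕ₁⊆ℤ (+ 1) (ℤ.<-≤-trans (ℤ.+<+ ℕ.z<s)) })
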